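{- Let $N\ge 1$ be an integer, and let $s$ and $e$ be independent random elements, uniformly distributed on $S_N$ and $E_N$ respectively. Let $n(x)=s(x)s(1/x)+e(x)\in Z_N$ be the corresponding noisy autocorrelation. Fix any index $j\in\{0,\ldots,N-1\}$, and let $s'\in S_N$ be obtained from $s$ by reversing the single sign in position $j$, i.e. $s'_j=-s_j$ and $s'_k=s_k$ for all $k\neq j$. Then the probability that there exists $e'\in E_N$ such that $$s'(x)s'(1/x)+e'(x)=n(x)$$ in $Z_N$ is equal to $(3/4)^{(N-1)/2}$ if $N$ is odd, and to $\tfrac12\,(3/4)^{N/2-1}$ if $N$ is even.
   Context: For a positive integer $N$, let $Z_N=\mathbb{Z}[x]/(x^N-1)$. Elements are written $p(x)=p_0+p_1x+\cdots+p_{N-1}x^{N-1}$, and coefficient indices are taken modulo $N$. In $Z_N$ the element $x$ is invertible with $1/x=x^{N-1}$, so $p(1/x)=\sum_{k} p_k x^{ -k}$ is well defined in $Z_N$. The set of sign sequences is $$S_N=\{s_0+s_1x+\cdots+s_{N-1}x^{N-1}\in Z_N : s_k=\pm1,\ 0\le k\le N-1\}.$$ For $s\in S_N$, the product $a(x)=s(x)s(1/x)\in Z_N$ is the (periodic) autocorrelation of $s$, with coefficients $a_k=\sum_{l=0}^{N-1}s_l s_{l+k}$ (indices mod $N$). The set of noise polynomials is $$E_N=\{e(x)\in Z_N : e_0=0;\ e_k=e_{ -k}=\pm 2 \text{ for } 1\le k\le \lfloor N/2\rfloor\},$$ where the signs for different $k\in\{1,\ldots,\lfloor N/2\rfloor\}$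 may be chosen arbitrarily, so $|E_N|=2^{\lfloor N/2\rfloor}$. -}

module Defs where

open import Algebra.Properties.CommutativeMonoid.Sum
  using (sum-syntax)
open import Data.Fin.Base using (Fin; toℕ; fromℕ<)
open import Data.Integer.Base as ℤ using (ℤ; +_; 0ℤ; 1ℤ; -1ℤ; _%ℕ_)
open import Data.Integer.DivMod using (n%ℕd<d)
open import Data.Integer.Properties using (+-0-commutativeMonoid)
open import Data.List.Base using (List; length)
open import Data.List.Membership.Propositional using (_∈_)
open import Data.List.Membership.Propositional.Properties.WithK
  using (unique∧set⇒bag)
open import Data.List.Relation.Binary.BagAndSetEquality using (∼bag⇒↭)
open import Data.List.Relation.Binary.Permutation.Propositional.Properties
  using (↭-length)
open import Data.List.Relation.Unary.Unique.Propositional using (Unique)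
open import Data.Nat.Base as ℕ using (ℕ; NonZero; ⌊_/2⌋)
open import Data.Product.Base using (_×_; _,_; Σ-syntax; ∃₂; ∃-syntax)
open import Data.Rational.Base using (ℚ; _/_; +-*-rawSemiring)
open import Data.Sum.Base using (_⊎_)
open import Data.Vec.Base using (Vec; lookup; tabulate; zipWith; _[_]%=_)
open import Function.Bundles using (_⇔_)
open import Function.Construct.Composition using (_⇔-∘_)
open import Function.Construct.Symmetry using (⇔-sym)
open import Level using (Level; _⊔_)
open import Relation.Binary.PropositionalEquality
  using (_≡_; refl; sym; trans)
open import Relation.Unary using (Pred; _∩_)

open import Algebra.Definitions.RawSemiring +-*-rawSemiring public
  using (_^_)

private
  variable
    a p q : Level
    A     : Set a
    N     : ℕ

------------------------------------------------------------------------
-- The ring Z_N = ℤ[x]/(x^N - 1)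

-- An element is given by its coefficients p₀ , … , p_{N-1} in the basis
-- 1 , x , … , x^{N-1}.

Z : ℕ → Set
Z N = Vec ℤ N

-- p ⟦ k ⟧ is the coefficient p_k, with the index k ∈ ℤ read modulo N.

infix 9 _⟦_⟧

_⟦_⟧ : .{{_ : NonZero N}} → Z N → ℤ → ℤ
_⟦_⟧ {N} p k = lookup p (fromℕ< (n%ℕd<d k N))

infixl 6 _⊕_
infixl 7 _⊛_

_⊕_ : Z N → Z N → Z N
_⊕_ = zipWith ℤ._+_

-- Since x^N = 1, multiplication is cyclic convolution of coefficients:
-- (p q)_k = Σ_l p_l q_{k-l}.

_⊛_ : .{{_ : NonZero N}} → Z N → Z N → Z N
_⊛_ {N} p q = tabulate λ k →
  sum-syntax +-0-commutativeMonoid N λ l →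
    lookup p l ℤ.* q ⟦ + toℕ k ℤ.- + toℕ l ⟧

-- p(1/x) = Σ_k p_k x^{-k}, whose coefficient at x^k is p_{-k}.

_⟨1/x⟩ : .{{_ : NonZero N}} → Z N → Z N
p ⟨1/x⟩ = tabulate λ k → p ⟦ ℤ.- (+ toℕ k) ⟧

------------------------------------------------------------------------
-- Sign sequences, noise polynomials and noisy autocorrelations

S : ∀ N → Pred (Z N) _
S N s = ∀ (k : Fin N) → lookup s k ≡ 1ℤ ⊎ lookup s k ≡ -1ℤ

E : ∀ N → .{{_ : NonZero N}} → Pred (Z N) _
E N e = e ⟦ 0ℤ ⟧ ≡ 0ℤ
      × (∀ (k : ℕ) → 1 ℕ.≤ k → k ℕ.≤ ⌊ N /2⌋ →
           e ⟦ + k ⟧ ≡ e ⟦ ℤ.- (+ k) ⟧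
         × (e ⟦ + k ⟧ ≡ + 2 ⊎ e ⟦ + k ⟧ ≡ ℤ.- (+ 2)))

noisyAutocorrelation : .{{_ : NonZero N}} → Z N → Z N → Z N
noisyAutocorrelation s e = s ⊛ s ⟨1/x⟩ ⊕ e

flipSign : Fin N → Z N → Z N
flipSign j s = s [ j ]%= ℤ.-_

FlipUndetected : ∀ N → .{{_ : NonZero N}} → Fin N → Pred (Z N × Z N) _
FlipUndetected N j (s , e) =
  ∃[ e′ ] E N e′
        × noisyAutocorrelation (flipSign j s) e′ ≡ noisyAutocorrelation s e

------------------------------------------------------------------------
-- Finite uniform probability

record HasCardinality {A : Set a} (P : Pred A p) (n : ℕ) : Set (a ⊔ p) where
  field
    elements : List A
    unique   : Unique elements
    member⇔  : ∀ x → x ∈ elements ⇔ P x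
    size     : length elements ≡ n

-- UniformProbability Ω B r : an element drawn uniformly from the finite
-- nonempty set Ω lies in B with probability |Ω ∩ B| / |Ω| = r.  The joint
-- law of independent uniform elements of two finite sets is the uniform
-- law on Ω = their cartesian product.

UniformProbability : {A : Set a} → Pred A p → Pred A q → ℚ → Set (a ⊔ p ⊔ q)
UniformProbability Ω B r =
  ∃₂ λ m n → HasCardinality (Ω ∩ B) m × HasCardinality Ω n
           × Σ[ n≢0 ∈ NonZero n ] r ≡ _/_ (+ m) n {{n≢0}}

-- Both relations are single-valued, so "the" cardinality and "the"
-- probability are meaningful.

cardinality-unique : {P : Pred A p} {m n : ℕ} →
  HasCardinality P m → HasCardinality P n → m ≡ n
cardinality-unique c d =
  trans (sym C.size) (trans (↭-length (∼bag⇒↭ sameBag)) D.size)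
  where
  module C = HasCardinality c
  module D = HasCardinality d
  sameBag = unique∧set⇒bag C.unique D.unique
              (λ {x} → ⇔-sym (D.member⇔ x) ⇔-∘ C.member⇔ x)

probability-unique : {Ω : Pred A p} {B : Pred A q} {r r′ : ℚ} →
  UniformProbability Ω B r → UniformProbability Ω B r′ → r ≡ r′
probability-unique (m , n , cm , cn , _ , refl) (m′ , n′ , cm′ , cn′ , _ , refl)
  with refl ← cardinality-unique cm cm′ | refl ← cardinality-unique cn cn′
  = refl

{-# OPTIONS --safe #-}
module Submission where

-- For k ≠ 0, reversing s_j lowers a_k by 2 s_j (s_{j+k} + s_{j-k}), while a_0 is
-- unchanged; so the flip is undetected iff e_k + 2 s_j (s_{j+k} + s_{j-k}) = ±2 for
-- all k ≠ 0.  In terms of u = s_j s_{j+k}, v = s_j s_{j-k} and w = e_k / 2 this fails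
-- only if u = v = w.  Each pair {k , -k} with k ≠ -k has its own independent signs
-- (u , v , w), of which 6 of 8 are good; for N even, k = N/2 forces u = v, and 2 of
-- the 4 choices of (u , w) are good.

open import Defs
open import Algebra.Properties.CommutativeMonoid.Sum
  using (sum; sum-cong-≗; ∑-distrib-+; sum-replicate-zero)
open import Data.Bool.Base using (if_then_else_)
open import Data.Empty using (⊥-elim)
open import Data.Fin.Base
  using (Fin; zero; suc; toℕ; fromℕ<; splitAt; _↑ˡ_; _↑ʳ_; opposite)
open import Data.Fin.Properties
  using (_≟_; toℕ<n; toℕ-fromℕ<; toℕ-injective; toℕ-↑ˡ; toℕ-↑ʳ; splitAt-↑ˡ; splitAt-↑ʳ;
         splitAt⁻¹-↑ˡ; splitAt⁻¹-↑ʳ; opposite-prop; opposite-involutive)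
open import Data.Integer.Base as ℤ
  using (ℤ; +_; -[1+_]; 0ℤ; 1ℤ; -1ℤ; _+_; _-_; -_; _◃_; sign)
open import Data.Integer.DivMod using (n%ℕd<d; a≡a%ℕn+[a/ℕn]*n)
import Data.Integer.Properties as ℤ
open import Data.Integer.Tactic.RingSolver using (solve-∀)
open import Data.List.Base as List using (List; []; _∷_; filter; length; cartesianProduct)
open import Data.List.Membership.Propositional using (_∈_)
open import Data.List.Membership.Propositional.Properties
  using (∈-map⁺; ∈-map⁻; ∈-cartesianProduct⁺; ∈-cartesianProduct⁻; ∈-filter⁺; ∈-filter⁻)
open import Data.List.Properties using (length-map; length-++)
open import Data.List.Relation.Unary.All using ([]; _∷_)
open import Data.List.Relation.Unary.AllPairs using ([]; _∷_)
open import Data.List.Relation.Unary.Any using (here; there)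
open import Data.List.Relation.Unary.Unique.Propositional using (Unique)
import Data.List.Relation.Unary.Unique.Propositional.Properties as Unique
open import Data.Nat.Base as ℕ using (ℕ; zero; suc; NonZero; z≤n; s≤s; _∸_; ⌊_/2⌋)
import Data.Nat.DivMod as ℕ
open import Data.Nat.Divisibility.Core using (_∣_; _∤_; divides)
import Data.Nat.Properties as ℕ
import Data.Nat.Tactic.RingSolver as ℕ
open import Data.Product.Base using (_×_; _,_; ∃-syntax; proj₁; proj₂; uncurry)
import Data.Rational.Properties as ℚ
import Data.Rational.Unnormalised.Base as ℚᵘ
import Data.Rational.Unnormalised.Properties as ℚᵘ
open import Data.Sign.Base as Sign using (Sign)
import Data.Sign.Properties as Sign
open import Data.Sum.Base using (_⊎_; inj₁; inj₂; [_,_]′)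
open import Data.Vec.Base using (Vec; []; _∷_; lookup; tabulate)
open import Data.Vec.Properties
  using (∷-injective; lookup∘tabulate; lookup∘updateAt; lookup∘updateAt′; lookup-zipWith;
         tabulate∘lookup; tabulate-cong)
open import Data.Vec.Relation.Unary.All using (All; []; _∷_)
open import Data.Vec.Relation.Unary.All.Properties using (lookup⁺; lookup⁻)
open import Function.Base using (_∘_)
open import Function.Bundles using (_⇔_; mk⇔; module Equivalence)
open import Function.Definitions using (Injective)
open import Level using (Level; 0ℓ)
open import Relation.Binary.PropositionalEquality
open import Relation.Nullary using (does; yes; no; contradiction; ¬?; _→-dec_)
open import Relation.Nullary.Decidable using (dec-false)
open import Relation.Unary using (Pred; Decidable; _∩_; U; _⟨×⟩_)
open import Relation.Unary.Properties using (U?)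

open Equivalence using (to; from)

-- Independence is never argued probabilistically. An explicit bijection from a product of finite
-- sign types onto S × E turns the event into a product of predicates, one per coordinate, so that
-- cardinalities multiply. Raw signs would not do: every constraint involves s_j, so the constraints
-- share a variable. Dividing each sign by s_j removes it from all of them and leaves it as a free
-- coordinate. The two parities of N are treated together by writing N = 1 + m + h + m with h ≤ 1,
-- where m counts the pairs {k , -k} with k ≠ -k and h counts the nonzero k with k = -k. One count
-- then gives (1/2)^h (3/4)^m, and parity enters only at the end.

private
  variable
    ℓ₁ ℓ₂ ℓ₃ ℓ₄ : Level
    A : Set ℓ₁
    B : Set ℓ₂
    P : Pred A ℓ₃
    Q : Pred B ℓ₄
    m n : ℕ

Vec-ext : {xs ys : Vec A n} → (∀ i → lookup xs i ≡ lookup ys i) → xs ≡ ys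
Vec-ext {xs = xs} {ys} eq =
  trans (sym (tabulate∘lookup xs)) (trans (tabulate-cong eq) (tabulate∘lookup ys))

-- Counting

-- Counting by bijection: injectivity keeps the image list free of repetitions, and the two
-- conditions make its members exactly `Q`.
HasCardinality-map : (f : A → B) → Injective _≡_ _≡_ f →
  (∀ {x} → P x → Q (f x)) → (∀ {y} → Q y → ∃[ x ] P x × f x ≡ y) →
  HasCardinality P n → HasCardinality Q n
HasCardinality-map {P = P} {Q = Q} f f-injective P⇒Q Q⇒P c = record
  { elements = List.map f elements
  ; unique   = Unique.map⁺ f-injective unique
  ; member⇔  = λ y → mk⇔ sound complete
  ; size     = trans (length-map f elements) size
  }
  where
  open HasCardinality c
  sound : ∀ {y} → y ∈ List.map f elements → Q y
  sound y∈ with x , x∈ , refl ← ∈-map⁻ f y∈ = P⇒Q (to (member⇔ x) x∈)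
  complete : ∀ {y} → Q y → y ∈ List.map f elements
  complete Qy with x , Px , refl ← Q⇒P Qy = ∈-map⁺ f (from (member⇔ x) Px)

length-cartesianProduct : ∀ (xs : List A) (ys : List B) →
  length (cartesianProduct xs ys) ≡ length xs ℕ.* length ys
length-cartesianProduct []       ys = refl
length-cartesianProduct (x ∷ xs) ys =
  trans (length-++ (List.map (x ,_) ys))
        (cong₂ ℕ._+_ (length-map (x ,_) ys) (length-cartesianProduct xs ys))

HasCardinality-× : HasCardinality P m → HasCardinality Q n →
  HasCardinality (P ⟨×⟩ Q) (m ℕ.* n)
HasCardinality-× {P = P} {Q = Q} c d = record
  { elements = cartesianProduct C.elements D.elements
  ; unique   = Unique.cartesianProduct⁺ C.unique D.unique
  ; member⇔  = λ (x , y) → mk⇔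
      (λ xy∈ → let x∈ , y∈ = ∈-cartesianProduct⁻ C.elements D.elements xy∈ in
        to (C.member⇔ x) x∈ , to (D.member⇔ y) y∈)
      (λ (Px , Qy) → ∈-cartesianProduct⁺ (from (C.member⇔ x) Px) (from (D.member⇔ y) Qy))
  ; size     = trans (length-cartesianProduct C.elements D.elements)
                     (cong₂ ℕ._*_ C.size D.size)
  }
  where
  module C = HasCardinality c
  module D = HasCardinality d

HasCardinality-Vec : HasCardinality P n → ∀ k → HasCardinality (All P {k}) (n ℕ.^ k)
HasCardinality-Vec c zero = record
  { elements = [] ∷ []
  ; unique   = [] ∷ []
  ; member⇔  = λ { [] → mk⇔ (λ _ → []) (λ _ → here refl) }
  ; size     = refl
  }
HasCardinality-Vec c (suc k) =
  HasCardinality-map (uncurry _∷_)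
    (λ eq → let eqˡ , eqʳ = ∷-injective eq in cong₂ _,_ eqˡ eqʳ)
    (λ (px , pxs) → px ∷ pxs)
    (λ { {x ∷ xs} (px ∷ pxs) → (x , xs) , (px , pxs) , refl })
    (HasCardinality-× c (HasCardinality-Vec c k))

HasCardinality-filter : {Q : Pred A ℓ₃} {xs : List A} →
  Unique xs → (∀ x → x ∈ xs) → (Q? : Decidable Q) → HasCardinality Q (length (filter Q? xs))
HasCardinality-filter {xs = xs} xs! x∈xs Q? = record
  { elements = filter Q? xs
  ; unique   = Unique.filter⁺ Q? xs!
  ; member⇔  = λ x → mk⇔ (proj₂ ∘ ∈-filter⁻ Q? {xs = xs}) (∈-filter⁺ Q? (x∈xs x))
  ; size     = refl
  }

-- Residues modulo N

infix 4 _≡_mod_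

-- Carrying the quotient as data turns each closure property of congruence into a ring identity.
record _≡_mod_ (k l : ℤ) (N : ℕ) : Set where
  constructor quotient-by
  field
    quotient : ℤ
    equality : k ≡ l + quotient ℤ.* + N

module _ {N : ℕ} where
  open import Data.Integer.Base using (_*_)

  mod-sym : ∀ {k l} → k ≡ l mod N → l ≡ k mod N
  mod-sym {l = l} (quotient-by q eq) = quotient-by (- q)
    (trans (lemma l q (+ N)) (cong (λ k → k + - q * + N) (sym eq)))
    where
    lemma : ∀ l q n → l ≡ l + q * n + - q * n
    lemma = solve-∀

  mod-trans : ∀ {k l m} → k ≡ l mod N → l ≡ m mod N → k ≡ m mod N
  mod-trans {m = m} (quotient-by q refl) (quotient-by r refl) =
    quotient-by (r + q) (lemma m q r (+ N))
    where
    lemma : ∀ m q r n → m + r * n + q * n ≡ m + (r + q) * n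
    lemma = solve-∀

  mod-+ˡ : ∀ c {k l} → k ≡ l mod N → c + k ≡ c + l mod N
  mod-+ˡ c {l = l} (quotient-by q refl) = quotient-by q (sym (ℤ.+-assoc c l (q * + N)))

  mod-neg : ∀ {k l} → k ≡ l mod N → - k ≡ - l mod N
  mod-neg {l = l} (quotient-by q refl) = quotient-by (- q) (lemma l q (+ N))
    where
    lemma : ∀ l q n → - (l + q * n) ≡ - l + - q * n
    lemma = solve-∀

  mod-remainder-unique : .{{_ : NonZero N}} → ∀ {a b} → a ℕ.< N → b ℕ.< N →
    + a ≡ + b mod N → a ≡ b
  mod-remainder-unique a<N b<N = λ
    { (quotient-by (+ q) eq)       → nonneg q a<N b<N eq
    -- Exchanging the two sides makes a negative quotient positive, so only natural quotients need
    -- an argument.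
    ; k≡l@(quotient-by -[1+ q ] _) → sym (nonneg (suc q) b<N a<N (_≡_mod_.equality (mod-sym k≡l)))
    }
    where
    open ≡-Reasoning
    nonneg : ∀ q {a b} → a ℕ.< N → b ℕ.< N → + a ≡ + b + + q * + N → a ≡ b
    nonneg q {a} {b} a<N b<N eq = begin
      a                      ≡⟨ ℕ.m<n⇒m%n≡m a<N ⟨
      a ℕ.% N                ≡⟨ cong (ℕ._% N) (ℤ.+-injective
                                 (trans eq (cong (_+_ (+ b)) (sym (ℤ.pos-* q N))))) ⟩
      (b ℕ.+ q ℕ.* N) ℕ.% N  ≡⟨ ℕ.[m+kn]%n≡m%n b q N ⟩
      b ℕ.% N                ≡⟨ ℕ.m<n⇒m%n≡m b<N ⟩
      b                      ∎

  module _ .{{_ : NonZero N}} where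

    -- This is the index used by `_⟦_⟧`: `p ⟦ k ⟧` unfolds to `lookup p (residue k)`.
    residue : ℤ → Fin N
    residue k = fromℕ< (n%ℕd<d k N)

    toℕ-residue : ∀ k → + toℕ (residue k) ≡ k mod N
    toℕ-residue k = mod-sym (quotient-by (k ℤ./ℕ N) (begin
      k                                     ≡⟨ a≡a%ℕn+[a/ℕn]*n k N ⟩
      + (k ℤ.%ℕ N) + k ℤ./ℕ N * + N         ≡⟨ cong (λ r → + r + k ℤ./ℕ N * + N)
                                                 (toℕ-fromℕ< (n%ℕd<d k N)) ⟨
      + toℕ (residue k) + k ℤ./ℕ N * + N    ∎))
      where open ≡-Reasoning

    residue-unique : ∀ {k} i → k ≡ + toℕ i mod N → residue k ≡ i
    residue-unique {k} i k≡i =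
      toℕ-injective (mod-remainder-unique (toℕ<n (residue k)) (toℕ<n i)
        (mod-trans (toℕ-residue k) k≡i))

    residue-cong : ∀ {k l} → k ≡ l mod N → residue k ≡ residue l
    residue-cong {l = l} k≡l = residue-unique (residue l) (mod-trans k≡l (mod-sym (toℕ-residue l)))

    residue-toℕ : ∀ i → residue (+ toℕ i) ≡ i
    residue-toℕ i = residue-unique i (quotient-by 0ℤ (sym (ℤ.+-identityʳ (+ toℕ i))))

    residue-injective : ∀ {k l} → residue k ≡ residue l → k ≡ l mod N
    residue-injective {k} {l} eq =
      mod-trans (mod-sym (toℕ-residue k))
        (subst (λ i → + toℕ i ≡ l mod N) (sym eq) (toℕ-residue l))

    -- Translation on the cyclic index group. It serves both as the shift in the autocorrelation and
    -- as the change of origin from 0 to the flipped index.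
    rotate : ℤ → Fin N → Fin N
    rotate c i = residue (c + + toℕ i)

    rotate-residue : ∀ c k → rotate c (residue k) ≡ residue (c + k)
    rotate-residue c k = residue-cong (mod-+ˡ c (toℕ-residue k))

    rotate-inverse : ∀ c i → rotate (- c) (rotate c i) ≡ i
    rotate-inverse c i = begin
      rotate (- c) (rotate c i)      ≡⟨ rotate-residue (- c) (c + + toℕ i) ⟩
      residue (- c + (c + + toℕ i))  ≡⟨ cong residue (lemma c (+ toℕ i)) ⟩
      residue (+ toℕ i)              ≡⟨ residue-toℕ i ⟩
      i                              ∎
      where
      open ≡-Reasoning
      lemma : ∀ c k → - c + (c + k) ≡ k
      lemma = solve-∀

    rotate-inverse′ : ∀ c i → rotate c (rotate (- c) i) ≡ i
    rotate-inverse′ c i =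
      trans (cong (λ d → rotate d (rotate (- c) i)) (sym (ℤ.neg-involutive c)))
        (rotate-inverse (- c) i)

-- Finite sums

∑ : ∀ {n} → (Fin n → ℤ) → ℤ
∑ = sum ℤ.+-0-commutativeMonoid

single : ∀ {n} → Fin n → ℤ → Fin n → ℤ
single p x l = if does (l ≟ p) then x else 0ℤ

single-≢ : ∀ {n} {p l : Fin n} x → l ≢ p → single p x l ≡ 0ℤ
single-≢ {p = p} {l} x l≢p = cong (if_then x else 0ℤ) (dec-false (l ≟ p) l≢p)

∑-single : ∀ {n} (p : Fin n) x → ∑ (single p x) ≡ x
∑-single {suc n} zero    x =
  trans (cong (_+_ x) (sum-replicate-zero ℤ.+-0-commutativeMonoid n)) (ℤ.+-identityʳ x)
∑-single {suc n} (suc p) x = trans (ℤ.+-identityˡ _) (∑-single p x)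

-- The difference of `f` and `g` is a sum of two point masses at distinct places. In the application
-- these are the two terms of a correlation sum that contain s_j.
∑-change-two : ∀ {n} (f g : Fin n → ℤ) {p q} x y → p ≢ q →
  f p ≡ g p + x → f q ≡ g q + y → (∀ l → l ≢ p → l ≢ q → f l ≡ g l) →
  ∑ f ≡ ∑ g + (x + y)
∑-change-two f g {p} {q} x y p≢q fp fq fl = begin
  ∑ f                                                ≡⟨ sum-cong-≗ M pointwise ⟩
  ∑ (λ l → g l + (single p x l + single q y l))      ≡⟨ ∑-distrib-+ M g _ ⟩
  ∑ g + ∑ (λ l → single p x l + single q y l)        ≡⟨ cong (_+_ (∑ g)) (∑-distrib-+ M (single p x) (single q y)) ⟩
  ∑ g + (∑ (single p x) + ∑ (single q y))            ≡⟨ cong₂ (λ u v → ∑ g + (u + v))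
                                                          (∑-single p x) (∑-single q y) ⟩
  ∑ g + (x + y)                                      ∎
  where
  open ≡-Reasoning
  M = ℤ.+-0-commutativeMonoid
  pointwise : ∀ l → f l ≡ g l + (single p x l + single q y l)
  pointwise l with l ≟ p
  ... | yes refl = trans fp (cong (_+_ (g p))
                     (sym (trans (cong (_+_ x) (single-≢ y p≢q)) (ℤ.+-identityʳ x))))
  ... | no l≢p with l ≟ q
  ...   | yes refl = trans fq (cong (_+_ (g q)) (sym (ℤ.+-identityˡ y)))
  ...   | no l≢q   = trans (fl l l≢p l≢q) (sym (ℤ.+-identityʳ (g l)))

-- The effect of a flip on the autocorrelation

module _ {N : ℕ} .{{_ : NonZero N}} where
  open import Data.Integer.Base using (_*_)

  -- Reversal in s(1/x) negates the convolution index k - l, which gives the form Σ s_l s_{l-k}.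
  lookup-autocorrelation : (s : Z N) (k : Fin N) →
    lookup (s ⊛ s ⟨1/x⟩) k ≡ ∑ (λ l → lookup s l * lookup s (rotate (- (+ toℕ k)) l))
  lookup-autocorrelation s k = trans (lookup∘tabulate _ k)
    (sum-cong-≗ ℤ.+-0-commutativeMonoid (λ l → cong (lookup s l *_) (begin
      s ⟨1/x⟩ ⟦ + toℕ k - + toℕ l ⟧
        ≡⟨ lookup∘tabulate _ (residue (+ toℕ k - + toℕ l)) ⟩
      s ⟦ - (+ toℕ (residue {N} (+ toℕ k - + toℕ l))) ⟧
        ≡⟨ cong (lookup s) (residue-cong {l = - (+ toℕ k - + toℕ l)}
             (mod-neg (toℕ-residue (+ toℕ k - + toℕ l)))) ⟩
      s ⟦ - (+ toℕ k - + toℕ l) ⟧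
        ≡⟨ cong (s ⟦_⟧) (lemma (+ toℕ k) (+ toℕ l)) ⟩
      s ⟦ - (+ toℕ k) + + toℕ l ⟧  ∎)))
    where
    open ≡-Reasoning
    lemma : ∀ k l → - (k - l) ≡ - k + l
    lemma = solve-∀

  module _ (j : Fin N) (s : Z N) where

    lookup-flipSign-≡ : lookup (flipSign j s) j ≡ - lookup s j
    lookup-flipSign-≡ = lookup∘updateAt j s

    lookup-flipSign-≢ : ∀ {l} → l ≢ j → lookup (flipSign j s) l ≡ lookup s l
    lookup-flipSign-≢ {l} l≢j = lookup∘updateAt′ l j l≢j s

    -- At shift 0 every term is a square, hence blind to the sign.
    autocorrelation-flipSign-0 : ∀ k → residue {N} 0ℤ ≡ k →
      lookup (flipSign j s ⊛ flipSign j s ⟨1/x⟩) k ≡ lookup (s ⊛ s ⟨1/x⟩) k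
    autocorrelation-flipSign-0 k refl = begin
      lookup (flipSign j s ⊛ flipSign j s ⟨1/x⟩) k  ≡⟨ lookup-autocorrelation (flipSign j s) k ⟩
      ∑ (λ l → lookup (flipSign j s) l * lookup (flipSign j s) (rotate (- (+ toℕ k)) l))
        ≡⟨ sum-cong-≗ ℤ.+-0-commutativeMonoid pointwise ⟩
      ∑ (λ l → lookup s l * lookup s (rotate (- (+ toℕ k)) l))  ≡⟨ lookup-autocorrelation s k ⟨
      lookup (s ⊛ s ⟨1/x⟩) k                        ∎
      where
      open ≡-Reasoning
      -- For abstract `N` the index `residue 0ℤ` does not compute to `zero`; it is only known to be
      -- congruent to 0.
      fixed : ∀ l → rotate (- (+ toℕ k)) l ≡ l
      fixed l = residue-unique l
        (subst₂ (λ x y → x ≡ y mod N) (ℤ.+-comm (+ toℕ l) (- (+ toℕ k))) (ℤ.+-identityʳ (+ toℕ l))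
          (mod-+ˡ (+ toℕ l) (mod-neg {l = 0ℤ} (toℕ-residue {N} 0ℤ))))
      neg-square : ∀ x → - x * - x ≡ x * x
      neg-square = solve-∀
      square : ∀ l → lookup (flipSign j s) l * lookup (flipSign j s) l ≡ lookup s l * lookup s l
      square l with l ≟ j
      ... | yes refl = trans (cong (λ x → x * x) lookup-flipSign-≡) (neg-square (lookup s j))
      ... | no  l≢j  = cong (λ x → x * x) (lookup-flipSign-≢ l≢j)
      pointwise : ∀ l → lookup (flipSign j s) l * lookup (flipSign j s) (rotate (- (+ toℕ k)) l)
                      ≡ lookup s l * lookup s (rotate (- (+ toℕ k)) l)
      pointwise l = begin
        lookup s′ l * lookup s′ (rotate (- (+ toℕ k)) l)
          ≡⟨ cong (λ i → lookup s′ l * lookup s′ i) (fixed l) ⟩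
        lookup s′ l * lookup s′ l
          ≡⟨ square l ⟩
        lookup s l * lookup s l
          ≡⟨ cong (λ i → lookup s l * lookup s i) (fixed l) ⟨
        lookup s l * lookup s (rotate (- (+ toℕ k)) l)  ∎
        where s′ = flipSign j s

    -- The sign s_j occurs in the terms l = j and l = j + k, which differ because k ≠ 0; each
    -- changes sign under the flip. They remain distinct when 2k = 0 mod N, so the same formula
    -- covers k = N / 2.
    autocorrelation-flipSign : ∀ {k} → residue {N} 0ℤ ≢ k →
      lookup (s ⊛ s ⟨1/x⟩) k ≡ lookup (flipSign j s ⊛ flipSign j s ⟨1/x⟩) k
        + + 2 * lookup s j * (s ⟦ + toℕ j + + toℕ k ⟧ + s ⟦ + toℕ j - + toℕ k ⟧)
    autocorrelation-flipSign {k} k≢0 = begin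
      lookup (s ⊛ s ⟨1/x⟩) k
        ≡⟨ lookup-autocorrelation s k ⟩
      ∑ (corr s)
        ≡⟨ ∑-change-two (corr s) (corr s′) (+ 2 * sⱼ * s₊) (+ 2 * sⱼ * s₋) j₊≢j at-j₊ at-j elsewhere ⟩
      ∑ (corr s′) + (+ 2 * sⱼ * s₊ + + 2 * sⱼ * s₋)
        ≡⟨ cong₂ _+_ (sym (lookup-autocorrelation s′ k)) (sym (ℤ.*-distribˡ-+ (+ 2 * sⱼ) s₊ s₋)) ⟩
      lookup (s′ ⊛ s′ ⟨1/x⟩) k + + 2 * sⱼ * (s₊ + s₋)  ∎
      where
      open ≡-Reasoning
      s′ = flipSign j s
      sⱼ = lookup s j
      s₊ = s ⟦ + toℕ j + + toℕ k ⟧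
      s₋ = s ⟦ + toℕ j - + toℕ k ⟧
      back : Fin N → Fin N
      back = rotate (- (+ toℕ k))
      corr : Z N → Fin N → ℤ
      corr t l = lookup t l * lookup t (back l)
      j₊ : Fin N
      j₊ = rotate (+ toℕ k) j
      lookup-j₊ : lookup s j₊ ≡ s₊
      lookup-j₊ = cong (s ⟦_⟧) (ℤ.+-comm (+ toℕ k) (+ toℕ j))
      lookup-back-j : lookup s (back j) ≡ s₋
      lookup-back-j = cong (s ⟦_⟧) (ℤ.+-comm (- (+ toℕ k)) (+ toℕ j))
      back-j₊ : back j₊ ≡ j
      back-j₊ = rotate-inverse (+ toℕ k) j
      back≡j : ∀ {l} → back l ≡ j → l ≡ j₊
      back≡j {l} refl = sym (rotate-inverse′ (+ toℕ k) l)
      fixed⇒0 : rotate (+ toℕ k) j ≡ j → residue {N} 0ℤ ≡ k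
      fixed⇒0 eq = residue-unique k (mod-sym
        (subst₂ (λ x y → x ≡ y mod N) (lemma (+ toℕ j) (+ toℕ k)) (ℤ.+-inverseˡ (+ toℕ j))
          (mod-+ˡ (- (+ toℕ j)) (residue-injective (trans eq (sym (residue-toℕ j)))))))
        where
        lemma : ∀ j k → - j + (k + j) ≡ k
        lemma = solve-∀
      j₊≢j : j₊ ≢ j
      j₊≢j = k≢0 ∘ fixed⇒0
      back-j≢j : back j ≢ j
      back-j≢j = j₊≢j ∘ sym ∘ back≡j
      at-j : corr s j ≡ corr s′ j + + 2 * sⱼ * s₋
      at-j = begin
        sⱼ * lookup s (back j)                        ≡⟨ cong (sⱼ *_) lookup-back-j ⟩
        sⱼ * s₋                                       ≡⟨ lemma sⱼ s₋ ⟩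
        - sⱼ * s₋ + + 2 * sⱼ * s₋
          ≡⟨ cong (_+ + 2 * sⱼ * s₋) (cong₂ _*_ lookup-flipSign-≡
               (trans (lookup-flipSign-≢ back-j≢j) lookup-back-j)) ⟨
        corr s′ j + + 2 * sⱼ * s₋                     ∎
        where
        lemma : ∀ x y → x * y ≡ - x * y + + 2 * x * y
        lemma = solve-∀
      at-j₊ : corr s j₊ ≡ corr s′ j₊ + + 2 * sⱼ * s₊
      at-j₊ = begin
        corr s j₊                                     ≡⟨ cong₂ _*_ lookup-j₊ (cong (lookup s) back-j₊) ⟩
        s₊ * sⱼ                                       ≡⟨ lemma sⱼ s₊ ⟩
        s₊ * - sⱼ + + 2 * sⱼ * s₊
          ≡⟨ cong (_+ + 2 * sⱼ * s₊) (cong₂ _*_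
               (trans (lookup-flipSign-≢ j₊≢j) lookup-j₊)
               (trans (cong (lookup s′) back-j₊) lookup-flipSign-≡)) ⟨
        corr s′ j₊ + + 2 * sⱼ * s₊                    ∎
        where
        lemma : ∀ x y → y * x ≡ y * - x + + 2 * x * y
        lemma = solve-∀
      elsewhere : ∀ l → l ≢ j₊ → l ≢ j → corr s l ≡ corr s′ l
      elsewhere l l≢j₊ l≢j =
        sym (cong₂ _*_ (lookup-flipSign-≢ l≢j) (lookup-flipSign-≢ (l≢j₊ ∘ back≡j)))

    -- The noise forced by the flipped sequence

    compensation : Z N → Z N
    compensation e = tabulate λ k → lookup e k +
      (lookup (s ⊛ s ⟨1/x⟩) k - lookup (flipSign j s ⊛ flipSign j s ⟨1/x⟩) k)

    lookup-compensation : ∀ e k → lookup (compensation e) k ≡ lookup e k +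
      (lookup (s ⊛ s ⟨1/x⟩) k - lookup (flipSign j s ⊛ flipSign j s ⟨1/x⟩) k)
    lookup-compensation e = lookup∘tabulate _

    -- The equation for e′ is additive, so it has exactly one solution in Z_N, namely e + a - a′.
    -- The existential thus becomes membership of one explicit polynomial.
    FlipUndetected⇔E : ∀ e → FlipUndetected N j (s , e) ⇔ E N (compensation e)
    FlipUndetected⇔E e = mk⇔
      (λ (e′ , e′∈E , eq) → subst (E N) (Vec-ext {xs = e′} {compensation e} (forced e′ eq)) e′∈E)
      (λ c∈E → compensation e , c∈E , Vec-ext solution)
      where
      open ≡-Reasoning
      a a′ : Z N
      a  = s ⊛ s ⟨1/x⟩
      a′ = flipSign j s ⊛ flipSign j s ⟨1/x⟩
      solution : ∀ k → lookup (a′ ⊕ compensation e) k ≡ lookup (a ⊕ e) k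
      solution k = begin
        lookup (a′ ⊕ compensation e) k
          ≡⟨ lookup-zipWith _+_ k a′ (compensation e) ⟩
        lookup a′ k + lookup (compensation e) k
          ≡⟨ cong (_+_ (lookup a′ k)) (lookup-compensation e k) ⟩
        lookup a′ k + (lookup e k + (lookup a k - lookup a′ k))
          ≡⟨ lemma (lookup a′ k) (lookup e k) (lookup a k) ⟩
        lookup a k + lookup e k
          ≡⟨ lookup-zipWith _+_ k a e ⟨
        lookup (a ⊕ e) k  ∎
        where
        lemma : ∀ a′ e a → a′ + (e + (a - a′)) ≡ a + e
        lemma = solve-∀
      forced : ∀ e′ → a′ ⊕ e′ ≡ a ⊕ e → ∀ k → lookup e′ k ≡ lookup (compensation e) k
      forced e′ eq k = begin
        lookup e′ k                                ≡⟨ lemma (lookup a′ k) (lookup e′ k) ⟩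
        lookup a′ k + lookup e′ k - lookup a′ k    ≡⟨ cong (_- lookup a′ k) (lookup-zipWith _+_ k a′ e′) ⟨
        lookup (a′ ⊕ e′) k - lookup a′ k           ≡⟨ cong (λ n → lookup n k - lookup a′ k) eq ⟩
        lookup (a ⊕ e) k - lookup a′ k             ≡⟨ cong (_- lookup a′ k) (lookup-zipWith _+_ k a e) ⟩
        lookup a k + lookup e k - lookup a′ k      ≡⟨ lemma′ (lookup a k) (lookup e k) (lookup a′ k) ⟩
        lookup e k + (lookup a k - lookup a′ k)    ≡⟨ lookup-compensation e k ⟨
        lookup (compensation e) k                  ∎
        where
        lemma : ∀ a′ e′ → e′ ≡ (a′ + e′) - a′
        lemma = solve-∀
        lemma′ : ∀ a e a′ → a + e - a′ ≡ e + (a - a′)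
        lemma′ = solve-∀

-- The indices k and -k

PlusMinusTwo : ℤ → Set
PlusMinusTwo x = x ≡ + 2 ⊎ x ≡ - (+ 2)

residue-neg : ∀ {N} .{{_ : NonZero N}} k (i : Fin N) → k ℕ.+ toℕ i ≡ N → residue (- (+ k)) ≡ i
residue-neg k i eq = residue-unique i (quotient-by (- (+ 1))
  (trans (lemma (+ k) (+ toℕ i)) (cong (λ n → + toℕ i + - (+ 1) * + n) eq)))
  where
  open import Data.Integer.Base using (_*_)
  lemma : ∀ k i → - k ≡ i + - (+ 1) * (k + i)
  lemma = solve-∀

module Positions (m h : ℕ) (h≤1 : h ℕ.≤ 1) where
  open import Data.Integer.Base using (_*_)

  N : ℕ
  N = suc (m ℕ.+ (h ℕ.+ m))

  -- pos i, neg i and half i stand for the residues i + 1, -(i + 1) and N / 2; since h ≤ 1,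
  -- the last one occurs exactly for even N.
  data Position : Set where
    origin  : Position
    pos neg : Fin m → Position
    half    : Fin h → Position

  index : Position → Fin N
  index origin   = zero
  index (pos i)  = suc (i ↑ˡ (h ℕ.+ m))
  index (half i) = suc (m ↑ʳ (i ↑ˡ m))
  -- The last block runs through -m , ... , -1, so -(i + 1) sits at the reversed offset.
  index (neg i)  = suc (m ↑ʳ (h ↑ʳ opposite i))

  position : Fin N → Position
  position zero    = origin
  position (suc k) = [ pos , [ half , neg ∘ opposite ]′ ∘ splitAt h ]′ (splitAt m k)

  position-index : ∀ p → position (index p) ≡ p
  position-index origin = refl
  position-index (pos i) rewrite splitAt-↑ˡ m i (h ℕ.+ m) = refl
  position-index (half i) rewrite splitAt-↑ʳ m (h ℕ.+ m) (i ↑ˡ m) | splitAt-↑ˡ h i m = refl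
  position-index (neg i) rewrite splitAt-↑ʳ m (h ℕ.+ m) (h ↑ʳ opposite i)
    | splitAt-↑ʳ h m (opposite i) = cong neg (opposite-involutive i)

  index-position : ∀ k → index (position k) ≡ k
  index-position zero = refl
  index-position (suc k) with splitAt m k in eq
  ... | inj₁ i = cong suc (splitAt⁻¹-↑ˡ eq)
  ... | inj₂ l with splitAt h l in eq′
  ...   | inj₁ i = cong suc (trans (cong (m ↑ʳ_) (splitAt⁻¹-↑ˡ eq′)) (splitAt⁻¹-↑ʳ eq))
  ...   | inj₂ i = cong suc (begin
    m ↑ʳ (h ↑ʳ opposite (opposite i))  ≡⟨ cong (λ i → m ↑ʳ (h ↑ʳ i)) (opposite-involutive i) ⟩
    m ↑ʳ (h ↑ʳ i)                      ≡⟨ cong (m ↑ʳ_) (splitAt⁻¹-↑ʳ eq′) ⟩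
    m ↑ʳ l                             ≡⟨ splitAt⁻¹-↑ʳ eq ⟩
    k                                  ∎)
    where open ≡-Reasoning

  opp : Position → Position
  opp origin   = origin
  opp (pos i)  = neg i
  opp (neg i)  = pos i
  opp (half i) = half i

  toℕ-pos : ∀ i → toℕ (index (pos i)) ≡ suc (toℕ i)
  toℕ-pos i = cong suc (toℕ-↑ˡ i (h ℕ.+ m))

  toℕ-half : ∀ i → toℕ (index (half i)) ≡ suc (m ℕ.+ toℕ i)
  toℕ-half i = cong suc (trans (toℕ-↑ʳ m (i ↑ˡ m)) (cong (m ℕ.+_) (toℕ-↑ˡ i m)))

  pos+neg≡N : ∀ i → toℕ (index (pos i)) ℕ.+ toℕ (index (neg i)) ≡ N
  pos+neg≡N i = begin
    toℕ (index (pos i)) ℕ.+ toℕ (index (neg i))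
      ≡⟨ cong₂ ℕ._+_ (toℕ-pos i) (cong suc (trans (toℕ-↑ʳ m (h ↑ʳ opposite i))
           (cong (m ℕ.+_) (trans (toℕ-↑ʳ h (opposite i)) (cong (h ℕ.+_) (opposite-prop i)))))) ⟩
    suc (toℕ i) ℕ.+ (suc m ℕ.+ (h ℕ.+ (m ℕ.∸ suc (toℕ i))))
      ≡⟨ lemma (suc (toℕ i)) (suc m) h (m ℕ.∸ suc (toℕ i)) ⟩
    suc m ℕ.+ (h ℕ.+ (suc (toℕ i) ℕ.+ (m ℕ.∸ suc (toℕ i))))
      ≡⟨ cong (λ n → suc m ℕ.+ (h ℕ.+ n)) (ℕ.m+[n∸m]≡n (toℕ<n i)) ⟩
    N  ∎
    where
    open ≡-Reasoning
    lemma : ∀ a b c d → a ℕ.+ (b ℕ.+ (c ℕ.+ d)) ≡ b ℕ.+ (c ℕ.+ (a ℕ.+ d))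
    lemma = ℕ.solve-∀

  half+half≡N : ∀ i → toℕ (index (half i)) ℕ.+ toℕ (index (half i)) ≡ N
  half+half≡N i = trans (cong (λ n → n ℕ.+ n) (toℕ-half i)) (lemma h≤1 i)
    where
    lemma : ∀ {h} → h ℕ.≤ 1 → (i : Fin h) →
      suc (m ℕ.+ toℕ i) ℕ.+ suc (m ℕ.+ toℕ i) ≡ suc (m ℕ.+ (h ℕ.+ m))
    -- An element of `Fin h` forces h = 1 and i = 0, hence N = 2 (m + 1).
    lemma (s≤s z≤n) zero rewrite ℕ.+-identityʳ m = refl

  residue-neg-index : ∀ p → residue (- (+ toℕ (index p))) ≡ index (opp p)
  residue-neg-index origin   = refl
  residue-neg-index (pos i)  = residue-neg (toℕ (index (pos i))) (index (neg i)) (pos+neg≡N i)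
  residue-neg-index (neg i)  =
    residue-neg (toℕ (index (neg i))) (index (pos i))
      (trans (ℕ.+-comm (toℕ (index (neg i))) (toℕ (index (pos i)))) (pos+neg≡N i))
  residue-neg-index (half i) = residue-neg (toℕ (index (half i))) (index (half i)) (half+half≡N i)

  ⌊N/2⌋≡m+h : ⌊ N /2⌋ ≡ m ℕ.+ h
  ⌊N/2⌋≡m+h = lemma h≤1
    where
    lemma : ∀ {h} → h ℕ.≤ 1 → ⌊ suc (m ℕ.+ (h ℕ.+ m)) /2⌋ ≡ m ℕ.+ h
    -- By definition `⌈ n /2⌉` is `⌊ suc n /2⌋`.
    lemma z≤n       = trans (sym (ℕ.n≡⌈n+n/2⌉ m)) (sym (ℕ.+-identityʳ m))
    lemma (s≤s z≤n) = trans (cong (λ n → ⌊ suc n /2⌋) (ℕ.+-suc m m))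
      (trans (cong suc (sym (ℕ.n≡⌊n+n/2⌋ m))) (sym (ℕ.+-comm m 1)))

  -- One element from each orbit {k , -k} with k ≠ 0. These are exactly the indices 1 , ... , ⌊N/2⌋
  -- constrained in `E`.
  data Representative : Position → Set where
    pos  : ∀ i → Representative (pos i)
    half : ∀ i → Representative (half i)

  representative-bounds : ∀ {p} → Representative p →
    1 ℕ.≤ toℕ (index p) × toℕ (index p) ℕ.≤ ⌊ N /2⌋
  representative-bounds (pos i) = s≤s z≤n ,
    subst₂ ℕ._≤_ (sym (toℕ-pos i)) (sym ⌊N/2⌋≡m+h) (ℕ.≤-trans (toℕ<n i) (ℕ.m≤m+n m h))
  representative-bounds (half i) = s≤s z≤n ,
    subst₂ ℕ._≤_ (trans (ℕ.+-suc m (toℕ i)) (sym (toℕ-half i))) (sym ⌊N/2⌋≡m+h)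
      (ℕ.+-monoʳ-≤ m (toℕ<n i))

  representative-cover : ∀ k → 1 ℕ.≤ k → k ℕ.≤ ⌊ N /2⌋ →
    ∃[ p ] Representative p × toℕ (index p) ≡ k
  representative-cover (suc k) _ k<⌊N/2⌋ = helper (splitAt m k′) refl
    where
    k<m+h : k ℕ.< m ℕ.+ h
    k<m+h = subst (suc k ℕ.≤_) ⌊N/2⌋≡m+h k<⌊N/2⌋
    k′ : Fin (m ℕ.+ h)
    k′ = fromℕ< k<m+h
    helper : ∀ x → splitAt m k′ ≡ x → ∃[ p ] Representative p × toℕ (index p) ≡ suc k
    helper (inj₁ i) eq = pos i , pos i , trans (toℕ-pos i) (cong suc
      (trans (sym (toℕ-↑ˡ i h)) (trans (cong toℕ (splitAt⁻¹-↑ˡ eq)) (toℕ-fromℕ< k<m+h))))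
    helper (inj₂ i) eq = half i , half i , trans (toℕ-half i) (cong suc
      (trans (sym (toℕ-↑ʳ m i)) (trans (cong toℕ (splitAt⁻¹-↑ʳ {m} eq)) (toℕ-fromℕ< k<m+h))))

  coeff : Z N → Position → ℤ
  coeff e p = lookup e (index p)

  -- Replaces the numerical range of k in `E` by positions, so that membership can be checked
  -- constructor by constructor.
  IsNoise : (Position → ℤ) → Set
  IsNoise f = f origin ≡ 0ℤ × (∀ {p} → Representative p → f p ≡ f (opp p) × PlusMinusTwo (f p))

  E⇔IsNoise : ∀ e → E N e ⇔ IsNoise (coeff e)
  E⇔IsNoise e = mk⇔ ⇒ ⇐
    where
    at+ : ∀ p → e ⟦ + toℕ (index p) ⟧ ≡ coeff e p
    at+ p = cong (lookup e) (residue-toℕ (index p))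
    at- : ∀ p → e ⟦ - (+ toℕ (index p)) ⟧ ≡ coeff e (opp p)
    at- p = cong (lookup e) (residue-neg-index p)
    ⇒ : E N e → IsNoise (coeff e)
    ⇒ (e₀ , eₖ) = e₀ , λ {p} r →
      let 1≤k , k≤N/2 = representative-bounds r
          even , ±2 = eₖ _ 1≤k k≤N/2
      in trans (sym (at+ p)) (trans even (at- p)) , subst PlusMinusTwo (at+ p) ±2
    ⇐ : IsNoise (coeff e) → E N e
    ⇐ (e₀ , eₚ) = e₀ , λ k 1≤k k≤N/2 → helper (representative-cover k 1≤k k≤N/2)
      where
      helper : ∀ {k} → ∃[ p ] Representative p × toℕ (index p) ≡ k →
        e ⟦ + k ⟧ ≡ e ⟦ - (+ k) ⟧ × PlusMinusTwo (e ⟦ + k ⟧)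
      helper (p , r , refl) =
        let even , ±2 = eₚ r
        in trans (at+ p) (trans even (sym (at- p))) , subst PlusMinusTwo (sym (at+ p)) ±2

  -- Sign positions counted from the flipped index

  module _ (j : Fin N) where

    -- The residue k goes to j + k. All dependence on `j` is absorbed into this relabelling of the
    -- signs.
    place : Position → Fin N
    place p = rotate (+ toℕ j) (index p)

    unplace : Fin N → Position
    unplace l = position (rotate (- (+ toℕ j)) l)

    unplace-place : ∀ p → unplace (place p) ≡ p
    unplace-place p = trans (cong position (rotate-inverse (+ toℕ j) (index p))) (position-index p)

    place-unplace : ∀ l → place (unplace l) ≡ l
    place-unplace l =
      trans (cong (rotate (+ toℕ j)) (index-position (rotate (- (+ toℕ j)) l)))
        (rotate-inverse′ (+ toℕ j) l)

    place-origin : place origin ≡ j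
    place-origin = trans (cong residue (ℤ.+-identityʳ (+ toℕ j))) (residue-toℕ j)

    module _ (s e : Z N) where

      private
        σ : Position → ℤ
        σ p = lookup s (place p)
        a a′ : Fin N → ℤ
        a  = lookup (s ⊛ s ⟨1/x⟩)
        a′ = lookup (flipSign j s ⊛ flipSign j s ⟨1/x⟩)

      coeff-compensation-origin : coeff (compensation j s e) origin ≡ coeff e origin
      coeff-compensation-origin = begin
        coeff (compensation j s e) origin      ≡⟨ lookup-compensation j s e zero ⟩
        lookup e zero + (a zero - a′ zero)     ≡⟨ cong (λ x → lookup e zero + (a zero - x))
                                                    (autocorrelation-flipSign-0 j s zero refl) ⟩
        lookup e zero + (a zero - a zero)      ≡⟨ lemma (lookup e zero) (a zero) ⟩
        coeff e origin                         ∎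
        where
        open ≡-Reasoning
        lemma : ∀ e a → e + (a - a) ≡ e
        lemma = solve-∀

      coeff-compensation : ∀ p → index p ≢ zero →
        coeff (compensation j s e) p ≡ coeff e p + + 2 * σ origin * (σ p + σ (opp p))
      coeff-compensation p p≢0 = begin
        coeff (compensation j s e) p
          ≡⟨ lookup-compensation j s e k ⟩
        lookup e k + (a k - a′ k)
          ≡⟨ cong (λ x → lookup e k + (x - a′ k)) (autocorrelation-flipSign j s (p≢0 ∘ sym)) ⟩
        lookup e k + (a′ k + x - a′ k)
          ≡⟨ lemma (lookup e k) (a′ k) x ⟩
        lookup e k + x
          ≡⟨ cong₂ (λ t u → lookup e k + + 2 * t * (σ p + u))
               (cong (lookup s) (sym place-origin))
               (cong (lookup s) (trans (sym (rotate-residue (+ toℕ j) (- (+ toℕ k))))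
                 (cong (rotate (+ toℕ j)) (residue-neg-index p)))) ⟩
        lookup e k + + 2 * σ origin * (σ p + σ (opp p))  ∎
        where
        open ≡-Reasoning
        k = index p
        x = + 2 * lookup s j * (σ p + s ⟦ + toℕ j - + toℕ k ⟧)
        lemma : ∀ e a′ x → e + (a′ + x - a′) ≡ e + x
        lemma = solve-∀

      -- Given e ∈ E, the constraints at k and −k on the compensated noise coincide.
      FlipUndetected⇔PlusMinusTwo : E N e → FlipUndetected N j (s , e) ⇔
        (∀ {p} → Representative p → PlusMinusTwo (coeff e p + + 2 * σ origin * (σ p + σ (opp p))))
      FlipUndetected⇔PlusMinusTwo e∈E = mk⇔
        (λ u {p} r → subst PlusMinusTwo (at r)
          (proj₂ (proj₂ (to (E⇔IsNoise (compensation j s e)) (to (FlipUndetected⇔E j s e) u)) r)))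
        (λ c → from (FlipUndetected⇔E j s e) (from (E⇔IsNoise (compensation j s e))
          ( trans coeff-compensation-origin (proj₁ e-noise)
          , λ {p} r → trans (at r) (trans (even r) (sym (at- r)))
          , subst PlusMinusTwo (sym (at r)) (c r))))
        where
        e-noise = to (E⇔IsNoise e) e∈E
        at : ∀ {p} → Representative p →
          coeff (compensation j s e) p ≡ coeff e p + + 2 * σ origin * (σ p + σ (opp p))
        at (pos i)  = coeff-compensation (pos i) λ ()
        at (half i) = coeff-compensation (half i) λ ()
        at- : ∀ {p} → Representative p →
          coeff (compensation j s e) (opp p) ≡ coeff e (opp p) + + 2 * σ origin * (σ (opp p) + σ p)
        at- (pos i)  = coeff-compensation (neg i) λ ()
        at- (half i) = coeff-compensation (half i) λ ()
        even : ∀ {p} → Representative p →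
            coeff e p + + 2 * σ origin * (σ p + σ (opp p))
          ≡ coeff e (opp p) + + 2 * σ origin * (σ (opp p) + σ p)
        even {p} r = cong₂ (λ x y → x + + 2 * σ origin * y)
          (proj₁ (proj₂ e-noise r)) (ℤ.+-comm (σ p) (σ (opp p)))

-- Parametrisation of S × E by independent signs

signs : List Sign
signs = Sign.+ ∷ Sign.- ∷ []

signs-unique : Unique signs
signs-unique = ((λ ()) ∷ []) ∷ [] ∷ []

∈-signs : ∀ t → t ∈ signs
∈-signs Sign.+ = here refl
∈-signs Sign.- = there (here refl)

-- For a concrete `Q?` the stated `length` evaluates to a numeral; the constants 4 and 2, and 8 and
-- 6 for triples, arise in this way.
HasCardinality-Sign² : {Q : Pred (Sign × Sign) 0ℓ} (Q? : Decidable Q) →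
  HasCardinality Q (length (filter Q? (cartesianProduct signs signs)))
HasCardinality-Sign² = HasCardinality-filter (Unique.cartesianProduct⁺ signs-unique signs-unique)
  (λ (u , v) → ∈-cartesianProduct⁺ (∈-signs u) (∈-signs v))

HasCardinality-Sign³ : {Q : Pred (Sign × Sign × Sign) 0ℓ} (Q? : Decidable Q) →
  HasCardinality Q (length (filter Q? (cartesianProduct signs (cartesianProduct signs signs))))
HasCardinality-Sign³ = HasCardinality-filter
  (Unique.cartesianProduct⁺ signs-unique (Unique.cartesianProduct⁺ signs-unique signs-unique))
  (λ (u , v , w) → ∈-cartesianProduct⁺ (∈-signs u) (∈-cartesianProduct⁺ (∈-signs v) (∈-signs w)))

NotAllEqual : Pred (Sign × Sign × Sign) 0ℓ
NotAllEqual (u , v , w) = u ≡ v → w ≢ u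

NotAllEqual? : Decidable NotAllEqual
NotAllEqual? (u , v , w) = (u Sign.≟ v) →-dec ¬? (w Sign.≟ u)

-- At k = N / 2 the two neighbours j + k and j - k coincide, so u and v are the same sign.
double : Sign × Sign → Sign × Sign × Sign
double (x , y) = x , x , y

sign-cancel : ∀ s t → s Sign.* (s Sign.* t) ≡ t
sign-cancel Sign.+ t      = refl
sign-cancel Sign.- Sign.+ = refl
sign-cancel Sign.- Sign.- = refl

sign-S : ∀ {x} → x ≡ 1ℤ ⊎ x ≡ -1ℤ → sign x ◃ 1 ≡ x
sign-S (inj₁ refl) = refl
sign-S (inj₂ refl) = refl

◃1-S : ∀ t → t ◃ 1 ≡ 1ℤ ⊎ t ◃ 1 ≡ -1ℤ
◃1-S Sign.+ = inj₁ refl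
◃1-S Sign.- = inj₂ refl

sign-PlusMinusTwo : ∀ {x} → PlusMinusTwo x → sign x ◃ 2 ≡ x
sign-PlusMinusTwo (inj₁ refl) = refl
sign-PlusMinusTwo (inj₂ refl) = refl

◃2-PlusMinusTwo : ∀ t → PlusMinusTwo (t ◃ 2)
◃2-PlusMinusTwo Sign.+ = inj₁ refl
◃2-PlusMinusTwo Sign.- = inj₂ refl

-- The factor `s` cancels against those inside the sum, leaving 2w + 2(u + v). This is 2w if u = -v,
-- it is 2u if u = v = -w, and it is ±6 if all three agree.
PlusMinusTwo⇔NotAllEqual : ∀ s u v w →
  PlusMinusTwo ((w ◃ 2) + + 2 ℤ.* (s ◃ 1) ℤ.* ((s Sign.* u ◃ 1) + (s Sign.* v ◃ 1))) ⇔
  NotAllEqual (u , v , w)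
PlusMinusTwo⇔NotAllEqual s u v w = mk⇔
  (fwd u v w ∘ subst PlusMinusTwo (absorb s u v))
  (subst PlusMinusTwo (sym (absorb s u v)) ∘ bwd u v w)
  where
  absorb : ∀ s u v → (w ◃ 2) + + 2 ℤ.* (s ◃ 1) ℤ.* ((s Sign.* u ◃ 1) + (s Sign.* v ◃ 1))
                   ≡ (w ◃ 2) + + 2 ℤ.* ((u ◃ 1) + (v ◃ 1))
  absorb Sign.+ _      _      = refl
  absorb Sign.- Sign.+ Sign.+ = refl
  absorb Sign.- Sign.+ Sign.- = refl
  absorb Sign.- Sign.- Sign.+ = refl
  absorb Sign.- Sign.- Sign.- = refl
  fwd : ∀ u v w → PlusMinusTwo ((w ◃ 2) + + 2 ℤ.* ((u ◃ 1) + (v ◃ 1))) → NotAllEqual (u , v , w)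
  fwd Sign.+ _ _ (inj₁ ()) refl refl
  fwd Sign.+ _ _ (inj₂ ()) refl refl
  fwd Sign.- _ _ (inj₁ ()) refl refl
  fwd Sign.- _ _ (inj₂ ()) refl refl
  bwd : ∀ u v w → NotAllEqual (u , v , w) → PlusMinusTwo ((w ◃ 2) + + 2 ℤ.* ((u ◃ 1) + (v ◃ 1)))
  bwd Sign.+ Sign.+ Sign.+ ne = ⊥-elim (ne refl refl)
  bwd Sign.+ Sign.+ Sign.- _  = inj₁ refl
  bwd Sign.+ Sign.- Sign.+ _  = inj₁ refl
  bwd Sign.+ Sign.- Sign.- _  = inj₂ refl
  bwd Sign.- Sign.+ Sign.+ _  = inj₁ refl
  bwd Sign.- Sign.+ Sign.- _  = inj₂ refl
  bwd Sign.- Sign.- Sign.+ _  = inj₂ refl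
  bwd Sign.- Sign.- Sign.- ne = ⊥-elim (ne refl refl)

module Count (m h : ℕ) (h≤1 : h ℕ.≤ 1) (j : Fin (suc (m ℕ.+ (h ℕ.+ m)))) where
  open Positions m h h≤1

  -- For k = i + 1, entry i of the triples is (s_j s_{j+k} , s_j s_{j-k} , e_k / 2); the pair,
  -- if present, is (s_j s_{j+N/2} , e_{N/2} / 2).
  Parameters : Set
  Parameters = Sign × Vec (Sign × Sign × Sign) m × Vec (Sign × Sign) h

  signAt : Parameters → Position → Sign
  signAt (s , us , xs) origin   = s
  signAt (s , us , xs) (pos i)  = s Sign.* proj₁ (lookup us i)
  signAt (s , us , xs) (neg i)  = s Sign.* proj₁ (proj₂ (lookup us i))
  signAt (s , us , xs) (half i) = s Sign.* proj₁ (lookup xs i)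

  noiseAt : Parameters → Position → ℤ
  noiseAt _             origin   = 0ℤ
  noiseAt (_ , us , xs) (pos i)  = proj₂ (proj₂ (lookup us i)) ◃ 2
  noiseAt (_ , us , xs) (neg i)  = proj₂ (proj₂ (lookup us i)) ◃ 2
  noiseAt (_ , us , xs) (half i) = proj₂ (lookup xs i) ◃ 2

  -- Signs are read relative to `j` but noise relative to 0, hence `unplace j` in one component and
  -- `position` in the other.
  decode : Parameters → Z N × Z N
  decode π = tabulate (λ l → signAt π (unplace j l) ◃ 1) , tabulate (noiseAt π ∘ position)

  lookup-decode₁ : ∀ π p → lookup (proj₁ (decode π)) (place j p) ≡ signAt π p ◃ 1
  lookup-decode₁ π p = trans (lookup∘tabulate (λ l → signAt π (unplace j l) ◃ 1) (place j p))
                             (cong (λ p → signAt π p ◃ 1) (unplace-place j p))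

  coeff-decode₂ : ∀ π p → coeff (proj₂ (decode π)) p ≡ noiseAt π p
  coeff-decode₂ π p = trans (lookup∘tabulate (noiseAt π ∘ position) (index p))
                            (cong (noiseAt π) (position-index p))

  decode-S : ∀ π → S N (proj₁ (decode π))
  decode-S π l = subst (λ x → x ≡ 1ℤ ⊎ x ≡ -1ℤ)
    (sym (lookup∘tabulate (λ l → signAt π (unplace j l) ◃ 1) l)) (◃1-S (signAt π (unplace j l)))

  decode-E : ∀ π → E N (proj₂ (decode π))
  decode-E π = from (E⇔IsNoise (proj₂ (decode π))) (coeff-decode₂ π origin , λ {p} r →
      trans (coeff-decode₂ π p) (trans (even r) (sym (coeff-decode₂ π (opp p))))
    , subst PlusMinusTwo (sym (coeff-decode₂ π p)) (±2 r))
    where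
    even : ∀ {p} → Representative p → noiseAt π p ≡ noiseAt π (opp p)
    even (pos i)  = refl
    even (half i) = refl
    ±2 : ∀ {p} → Representative p → PlusMinusTwo (noiseAt π p)
    ±2 (pos i)  = ◃2-PlusMinusTwo (proj₂ (proj₂ (lookup (proj₁ (proj₂ π)) i)))
    ±2 (half i) = ◃2-PlusMinusTwo (proj₂ (lookup (proj₂ (proj₂ π)) i))

  -- The value at `origin` recovers s_j, which then cancels from the products at all other
  -- positions.
  decode-injective : Injective _≡_ _≡_ decode
  decode-injective {π@(s , us , xs)} {π′@(s′ , us′ , xs′)} eq =
    cong₂ _,_ (signs≡ origin) (cong₂ _,_
      (Vec-ext λ i → cong₂ _,_ (cancel (signs≡ (pos i)))
        (cong₂ _,_ (cancel (signs≡ (neg i))) (noise≡ (noiseAt≡ (pos i)))))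
      (Vec-ext λ i → cong₂ _,_ (cancel (signs≡ (half i))) (noise≡ (noiseAt≡ (half i)))))
    where
    signs≡ : ∀ p → signAt π p ≡ signAt π′ p
    signs≡ p = ℤ.sign-cong {1} {1} (trans (sym (lookup-decode₁ π p))
      (trans (cong (λ (t , _) → lookup t (place j p)) eq) (lookup-decode₁ π′ p)))
    noiseAt≡ : ∀ p → noiseAt π p ≡ noiseAt π′ p
    noiseAt≡ p = trans (sym (coeff-decode₂ π p))
      (trans (cong (λ (_ , e) → coeff e p) eq) (coeff-decode₂ π′ p))
    noise≡ : ∀ {t u} → t ◃ 2 ≡ u ◃ 2 → t ≡ u
    noise≡ = ℤ.sign-cong {2} {2}
    cancel : ∀ {t u} → s Sign.* t ≡ s′ Sign.* u → t ≡ u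
    cancel {t} {u} eq = trans (sym (sign-cancel s t))
      (trans (cong₂ Sign._*_ (signs≡ origin) eq) (sign-cancel s′ u))

  decode-surjective : ∀ {y} → (S N ⟨×⟩ E N) y → ∃[ π ] decode π ≡ y
  decode-surjective {s , e} (s∈S , e∈E) = π , cong₂ _,_
    (Vec-ext λ l → begin
      lookup (proj₁ (decode π)) l                    ≡⟨ lookup∘tabulate (λ l → signAt π (unplace j l) ◃ 1) l ⟩
      signAt π (unplace j l) ◃ 1                     ≡⟨ cong (_◃ 1) (signAt≡ (unplace j l)) ⟩
      σ (unplace j l) ◃ 1                            ≡⟨ sign-S (s∈S (place j (unplace j l))) ⟩
      lookup s (place j (unplace j l))               ≡⟨ cong (lookup s) (place-unplace j l) ⟩
      lookup s l                                     ∎)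
    (Vec-ext λ k → begin
      lookup (proj₂ (decode π)) k   ≡⟨ lookup∘tabulate (noiseAt π ∘ position) k ⟩
      noiseAt π (position k)        ≡⟨ noiseAt≡ (position k) ⟩
      coeff e (position k)          ≡⟨ cong (lookup e) (index-position k) ⟩
      lookup e k                    ∎)
    where
    open ≡-Reasoning
    σ : Position → Sign
    σ p = sign (lookup s (place j p))
    -- Every sign is its own inverse, so multiplying by s_j is dividing by it.
    ratio : Position → Sign
    ratio p = σ origin Sign.* σ p
    triple : Fin m → Sign × Sign × Sign
    triple i = ratio (pos i) , ratio (neg i) , sign (coeff e (pos i))
    pair : Fin h → Sign × Sign
    pair i = ratio (half i) , sign (coeff e (half i))
    π : Parameters
    π = σ origin , tabulate triple , tabulate pair
    signAt≡ : ∀ p → signAt π p ≡ σ p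
    signAt≡ origin = refl
    signAt≡ (pos i) =
      trans (cong (λ (u , _) → σ origin Sign.* u) (lookup∘tabulate triple i))
        (sign-cancel (σ origin) (σ (pos i)))
    signAt≡ (neg i) =
      trans (cong (λ (_ , v , _) → σ origin Sign.* v) (lookup∘tabulate triple i))
        (sign-cancel (σ origin) (σ (neg i)))
    signAt≡ (half i) =
      trans (cong (λ (x , _) → σ origin Sign.* x) (lookup∘tabulate pair i))
        (sign-cancel (σ origin) (σ (half i)))
    e-noise : IsNoise (coeff e)
    e-noise = to (E⇔IsNoise e) e∈E
    at-pos : ∀ i → noiseAt π (pos i) ≡ coeff e (pos i)
    at-pos i = trans (cong (λ (_ , _ , w) → w ◃ 2) (lookup∘tabulate triple i))
      (sign-PlusMinusTwo (proj₂ (proj₂ e-noise (pos i))))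
    noiseAt≡ : ∀ p → noiseAt π p ≡ coeff e p
    noiseAt≡ origin = sym (proj₁ e-noise)
    noiseAt≡ (pos i) = at-pos i
    -- Only the noise at `pos i` is stored; at `neg i` the symmetry required by `E` supplies it.
    noiseAt≡ (neg i) = trans (at-pos i) (proj₁ (proj₂ e-noise (pos i)))
    noiseAt≡ (half i) = trans (cong (λ (_ , y) → y ◃ 2) (lookup∘tabulate pair i))
      (sign-PlusMinusTwo (proj₂ (proj₂ e-noise (half i))))

  -- Each coordinate is constrained separately and s_j is free, so the count is a product.
  Undetected : Pred Parameters 0ℓ
  Undetected = U ⟨×⟩ All NotAllEqual ⟨×⟩ All (NotAllEqual ∘ double)

  FlipUndetected-decode : ∀ π → FlipUndetected N j (decode π) ⇔ Undetected π
  FlipUndetected-decode π@(s , us , xs) = mk⇔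
    (λ u → let c = to flip⇔ u in
      _ , lookup⁻ (λ i → to (local (pos i)) (c (pos i)))
        , lookup⁻ (λ i → to (local (half i)) (c (half i))))
    (λ (_ , ps , hs) → from flip⇔ λ
      { (pos i)  → from (local (pos i)) (lookup⁺ ps i)
      ; (half i) → from (local (half i)) (lookup⁺ hs i) })
    where
    t = proj₁ (decode π)
    e = proj₂ (decode π)
    flip⇔ = FlipUndetected⇔PlusMinusTwo j t e (decode-E π)
    Local : ∀ {p} → Representative p → Set
    Local (pos i)  = NotAllEqual (lookup us i)
    Local (half i) = NotAllEqual (double (lookup xs i))
    local : ∀ {p} (r : Representative p) → PlusMinusTwo
      (coeff e p + + 2 ℤ.* lookup t (place j origin)
                     ℤ.* (lookup t (place j p) + lookup t (place j (opp p)))) ⇔ Local r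
    local {p} r rewrite coeff-decode₂ π p | lookup-decode₁ π origin | lookup-decode₁ π p
      | lookup-decode₁ π (opp p) = at r
      where
      at : ∀ {p} (r : Representative p) → PlusMinusTwo
        (noiseAt π p + + 2 ℤ.* (s ◃ 1) ℤ.* ((signAt π p ◃ 1) + (signAt π (opp p) ◃ 1))) ⇔ Local r
      at (pos i)  = let u , v , w = lookup us i in PlusMinusTwo⇔NotAllEqual s u v w
      at (half i) = let x , y = lookup xs i in PlusMinusTwo⇔NotAllEqual s x x y

  -- Counting through the same `decode`, with trivial predicates, gives the total the same shape as
  -- the favourable count, so the ratio can be taken factor by factor.
  HasCardinality-Ω : HasCardinality (S N ⟨×⟩ E N) (2 ℕ.* (8 ℕ.^ m ℕ.* 4 ℕ.^ h))
  HasCardinality-Ω = HasCardinality-map decode decode-injective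
    (λ {π} _ → decode-S π , decode-E π)
    (λ y∈ → let π , eq = decode-surjective y∈ in
      π , (_ , lookup⁻ _ , lookup⁻ _) , eq)
    (HasCardinality-× (HasCardinality-filter signs-unique ∈-signs U?)
      (HasCardinality-× (HasCardinality-Vec (HasCardinality-Sign³ U?) m)
        (HasCardinality-Vec (HasCardinality-Sign² U?) h)))

  HasCardinality-undetected :
    HasCardinality ((S N ⟨×⟩ E N) ∩ FlipUndetected N j) (2 ℕ.* (6 ℕ.^ m ℕ.* 2 ℕ.^ h))
  HasCardinality-undetected = HasCardinality-map decode decode-injective
    (λ {π} undetected → (decode-S π , decode-E π) , from (FlipUndetected-decode π) undetected)
    (λ (y∈ , undetected) → let π , eq = decode-surjective y∈ in
      π , to (FlipUndetected-decode π) (subst (FlipUndetected N j) (sym eq) undetected) , eq)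
    (HasCardinality-× (HasCardinality-filter signs-unique ∈-signs U?)
      (HasCardinality-× (HasCardinality-Vec (HasCardinality-Sign³ NotAllEqual?) m)
        (HasCardinality-Vec (HasCardinality-Sign² (NotAllEqual? ∘ double)) h)))

-- The ratio of the two cardinalities

open import Data.Rational.Base using (_/_; _*_; ½; toℚᵘ; fromℚᵘ)

fromℚᵘ-homo-* : ∀ p q → fromℚᵘ (p ℚᵘ.* q) ≡ fromℚᵘ p * fromℚᵘ q
fromℚᵘ-homo-* p q = ℚ.toℚᵘ-injective (begin
  toℚᵘ (fromℚᵘ (p ℚᵘ.* q))               ≈⟨ ℚ.toℚᵘ-fromℚᵘ (p ℚᵘ.* q) ⟩
  p ℚᵘ.* q                               ≈⟨ ℚᵘ.*-cong (ℚ.toℚᵘ-fromℚᵘ p) (ℚ.toℚᵘ-fromℚᵘ q) ⟨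
  toℚᵘ (fromℚᵘ p) ℚᵘ.* toℚᵘ (fromℚᵘ q)   ≈⟨ ℚ.toℚᵘ-homo-* (fromℚᵘ p) (fromℚᵘ q) ⟨
  toℚᵘ (fromℚᵘ p * fromℚᵘ q)             ∎)
  where open import Relation.Binary.Reasoning.Setoid ℚᵘ.≃-setoid

-- With successor denominators `_/_` is `fromℚᵘ` of an unreduced fraction, and those multiply
-- componentwise; reasoning about gcds is thereby avoided.
/-homo-* : ∀ a b c d .{{_ : NonZero b}} .{{_ : NonZero d}} .{{_ : NonZero (b ℕ.* d)}} →
  + (a ℕ.* c) / (b ℕ.* d) ≡ (+ a / b) * (+ c / d)
/-homo-* a b@(suc b-1) c d@(suc d-1) =
  trans (cong (_/ (b ℕ.* d)) (ℤ.pos-* a c))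
    (fromℚᵘ-homo-* (ℚᵘ.mkℚᵘ (+ a) b-1) (ℚᵘ.mkℚᵘ (+ c) d-1))

/-homo-^ : ∀ a b .{{_ : NonZero b}} n .{{_ : NonZero (b ℕ.^ n)}} →
  + (a ℕ.^ n) / (b ℕ.^ n) ≡ (+ a / b) ^ n
/-homo-^ a b zero    = refl
/-homo-^ a b (suc n) =
  trans (/-homo-* a b (a ℕ.^ n) (b ℕ.^ n)) (cong ((+ a / b) *_) (/-homo-^ a b n))
  where instance b^n≢0 = ℕ.m^n≢0 b n

denominator≢0 : ∀ m h → NonZero (2 ℕ.* (8 ℕ.^ m ℕ.* 4 ℕ.^ h))
denominator≢0 m h = ℕ.m*n≢0 2 _ {{_}} {{ℕ.m*n≢0 (8 ℕ.^ m) (4 ℕ.^ h) {{ℕ.m^n≢0 8 m}} {{ℕ.m^n≢0 4 h}}}}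

undetected-ratio : ∀ m h .{{_ : NonZero (2 ℕ.* (8 ℕ.^ m ℕ.* 4 ℕ.^ h))}} →
  ½ ^ h * (+ 3 / 4) ^ m ≡ + (2 ℕ.* (6 ℕ.^ m ℕ.* 2 ℕ.^ h)) / (2 ℕ.* (8 ℕ.^ m ℕ.* 4 ℕ.^ h))
undetected-ratio m h = begin
  -- Both `+ 2 / 4` and `+ 6 / 8` evaluate to lowest terms, so this line agrees with the stated left
  -- side by computation.
  (+ 2 / 4) ^ h * (+ 6 / 8) ^ m  ≡⟨ ℚ.*-comm ((+ 2 / 4) ^ h) ((+ 6 / 8) ^ m) ⟩
  (+ 6 / 8) ^ m * (+ 2 / 4) ^ h  ≡⟨ cong₂ _*_ (/-homo-^ 6 8 m) (/-homo-^ 2 4 h) ⟨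
  (+ (6 ℕ.^ m) / (8 ℕ.^ m)) * (+ (2 ℕ.^ h) / (4 ℕ.^ h))
                                 ≡⟨ /-homo-* (6 ℕ.^ m) (8 ℕ.^ m) (2 ℕ.^ h) (4 ℕ.^ h) ⟨
  good / total                   ≡⟨ ℚ.*-identityˡ (good / total) ⟨
  -- The free sign s_j contributes `+ 2 / 2`, which evaluates to 1.
  (+ 2 / 2) * (good / total)     ≡⟨ /-homo-* 2 2 (6 ℕ.^ m ℕ.* 2 ℕ.^ h) total ⟨
  + (2 ℕ.* (6 ℕ.^ m ℕ.* 2 ℕ.^ h)) / (2 ℕ.* total)  ∎
  where
  open ≡-Reasoning
  total = 8 ℕ.^ m ℕ.* 4 ℕ.^ h
  good = + (6 ℕ.^ m ℕ.* 2 ℕ.^ h)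
  instance
    8^m≢0 = ℕ.m^n≢0 8 m
    4^h≢0 = ℕ.m^n≢0 4 h
    total≢0 = ℕ.m*n≢0 (8 ℕ.^ m) (4 ℕ.^ h)

-- The probability for each parity of N

UniformProbability-FlipUndetected : ∀ m h (h≤1 : h ℕ.≤ 1) → let N = suc (m ℕ.+ (h ℕ.+ m)) in
  (j : Fin N) → ∀ {r} → r ≡ ½ ^ h * (+ 3 / 4) ^ m →
  UniformProbability (S N ⟨×⟩ E N) (FlipUndetected N j) r
UniformProbability-FlipUndetected m h h≤1 j eq =
  _ , _ , HasCardinality-undetected , HasCardinality-Ω , total≢0 ,
  trans eq (undetected-ratio m h {{total≢0}})
  where
  open Count m h h≤1 j
  total≢0 = denominator≢0 m h

-- Applied to N - 1. The sums are left as `0 ℕ.+ m` and `1 ℕ.+ m` so that matching on `refl` puts N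
-- in the form 1 + (m + (h + m)).
parity : ∀ n → ∃[ m ] (n ≡ m ℕ.+ (0 ℕ.+ m) ⊎ n ≡ m ℕ.+ (1 ℕ.+ m))
parity zero = 0 , inj₁ refl
parity (suc n) with parity n
... | m , inj₁ refl = m , inj₂ (sym (ℕ.+-suc m m))
... | m , inj₂ refl = suc m , inj₁ refl

theorem1p1 : ∀ (N : ℕ) .{{_ : NonZero N}} (j : Fin N) →
    (2 ∤ N → UniformProbability (S N ⟨×⟩ E N) (FlipUndetected N j)
    ((+ 3 / 4) ^ ⌊ N ∸ 1 /2⌋))
    × (2 ∣ N → UniformProbability (S N ⟨×⟩ E N) (FlipUndetected N j)
    (½ * (+ 3 / 4) ^ (⌊ N /2⌋ ∸ 1)))
theorem1p1 (suc n) j with parity n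
... | m , inj₁ refl = (λ _ → UniformProbability-FlipUndetected m 0 z≤n j (begin
    (+ 3 / 4) ^ ⌊ m ℕ.+ m /2⌋  ≡⟨ cong ((+ 3 / 4) ^_) (ℕ.n≡⌊n+n/2⌋ m) ⟨
    (+ 3 / 4) ^ m              ≡⟨ ℚ.*-identityˡ ((+ 3 / 4) ^ m) ⟨
    ½ ^ 0 * (+ 3 / 4) ^ m      ∎))
  , λ (divides k eq) → contradiction
      (trans (ℕ.*-comm 2 k) (trans (sym eq) (cong (λ x → suc (m ℕ.+ x)) (sym (ℕ.+-identityʳ m)))))
      (ℕ.even≢odd k m)
  where open ≡-Reasoning
... | m , inj₂ refl = (λ 2∤N → contradiction (divides (suc m) (even m)) 2∤N)
  , λ _ → UniformProbability-FlipUndetected m 1 (s≤s z≤n) j (cong (λ k → ½ * (+ 3 / 4) ^ k)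
      (trans (cong (_∸ 1) (Positions.⌊N/2⌋≡m+h m 1 (s≤s z≤n))) (ℕ.m+n∸n≡m m 1)))
  where
  even : ∀ m → suc (m ℕ.+ (1 ℕ.+ m)) ≡ suc m ℕ.* 2
  even = ℕ.solve-∀
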